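{- Let $\ell\ge 2$ be an integer. The generating function $\sum_{n\geq 1}|\mathcal P_n(\{12\cdots\ell 1\})|\,x^n$ is given by $$\frac{x^{\ell-1}(1-(\ell-1)x)}{\prod_{j=1}^{\ell}(1-jx)}+\sum_{i=1}^{\ell-2}\frac{x^i}{\prod_{j=1}^i(1-jx)}.$$
   Context: A restricted growth sequence of length $n$ is a sequence of positive integers $\pi=\pi_1\cdots\pi_n$ with $\pi_1=1$ and $\pi_{j+1}\le 1+\max\{\pi_1,\dots,\pi_j\}$ for all $1\le j<n$. Such a sequence contains a pattern $\tau$ if it has a (not necessarily consecutive) subsequence order isomorphic to $\tau$ (same relative order, including equalities); otherwise it avoids $\tau$. $\mathcal P_n(B)$ is the set of restricted growth sequences of length $n$ that avoid all patterns in $B$. The pattern $12\cdots\ell1$ is the word of length $\ell+1$ consisting of $1,2,\dots,\ell$ followed by $1$. -}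

module Defs where

open import Data.Fin.Base as Fin using (Fin; toℕ; cast)
import Data.Fin.Properties as Fin
open import Data.Integer.Base as ℤ using (ℤ; +_; 0ℤ; 1ℤ)
import Data.Integer.Properties as ℤ
open import Data.List.Base
  using (List; []; _∷_; [_]; _∷ʳ_; length; lookup; take; head; filter; applyUpTo; cartesianProductWith)
open import Data.List.Extrema.Nat using (max; max≤v⁺)
open import Data.List.Membership.Propositional using (_∈_)
open import Data.List.Membership.Propositional.Properties
  using (∈-cartesianProductWith⁺; ∈-applyUpTo⁺; ∈-filter⁺; ∈-filter⁻)
import Data.List.Properties as List
open import Data.List.Relation.Binary.Sublist.Propositional using (_⊆_; []; _∷_) renaming (_∷ʳ_ to skip)
open import Data.List.Relation.Unary.All as All using (All; []; _∷_; all?)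
import Data.List.Relation.Unary.All.Properties as All
open import Data.List.Relation.Unary.Any using (here)
open import Data.List.Relation.Unary.Unique.Propositional using (Unique; []; _∷_)
import Data.List.Relation.Unary.Unique.Propositional.Properties as Unique
open import Data.Maybe.Base using (just)
import Data.Maybe.Properties as Maybe
open import Data.Nat.Base as ℕ using (ℕ; zero; suc; _≤_; _<_; _∸_; z≤n; s≤s)
import Data.Nat.Properties as ℕ
open import Data.Product.Base using (∃-syntax; _×_; _,_; proj₂)
open import Function.Base using (_∘_)
open import Function.Bundles using (_⇔_; mk⇔; Equivalence)
open import Relation.Binary.PropositionalEquality
  using (_≡_; refl; sym; trans; cong; cong₂; subst; module ≡-Reasoning)
open import Relation.Nullary.Decidable using (Dec; yes; no; map′; ¬?; _×-dec_; _→-dec_)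
open import Relation.Nullary.Negation using (¬_)
open import Relation.Unary using (Decidable)

open import Algebra.Properties.Semiring.Sum ℤ.+-*-semiring using (sum⁺-syntax)

-- Positions are 0-based: `lookup π j` is π_{j+1} and `take (toℕ j) π` is
-- π_1 ⋯ π_j.
record IsRestrictedGrowth (π : List ℕ) : Set where
  field
    positive : All (1 ≤_) π
    starts   : head π ≡ just 1
    growth   : ∀ (j : Fin (length π)) → 1 ≤ toℕ j →
               lookup π j ≤ 1 ℕ.+ max 0 (take (toℕ j) π)

record OrderIsomorphic (σ τ : List ℕ) : Set where
  field
    length-≡ : length σ ≡ length τ
    <-iff    : ∀ (i j : Fin (length σ)) →
               (lookup σ i < lookup σ j) ⇔
               (lookup τ (cast length-≡ i) < lookup τ (cast length-≡ j))
    ≡-iff    : ∀ (i j : Fin (length σ)) →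
               (lookup σ i ≡ lookup σ j) ⇔
               (lookup τ (cast length-≡ i) ≡ lookup τ (cast length-≡ j))

-- `_⊆_` is the (not necessarily contiguous) subsequence relation.
Contains : List ℕ → List ℕ → Set
Contains π τ = ∃[ σ ] σ ⊆ π × OrderIsomorphic σ τ

Avoids : List ℕ → List ℕ → Set
Avoids π τ = ¬ Contains π τ

-- The set B of forbidden patterns is given by a list of its elements.
record _∈𝒫[_,_] (π : List ℕ) (n : ℕ) (B : List (List ℕ)) : Set where
  constructor mk
  field
    length-≡         : length π ≡ n
    restrictedGrowth : IsRestrictedGrowth π
    avoids           : All (Avoids π) B

private
  _⇔-dec_ : ∀ {A B : Set} → Dec A → Dec B → Dec (A ⇔ B)
  a? ⇔-dec b? = map′ (λ (f , g) → mk⇔ f g)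
                     (λ e → Equivalence.to e , Equivalence.from e)
                     ((a? →-dec b?) ×-dec (b? →-dec a?))

  anySublist? : ∀ {P : List ℕ → Set} → Decidable P →
                ∀ xs → Dec (∃[ σ ] σ ⊆ xs × P σ)
  anySublist? P? [] with P? []
  ... | yes p = yes ([] , [] , p)
  ... | no ¬p = no λ { ([] , [] , p) → ¬p p }
  anySublist? P? (x ∷ xs) with anySublist? (P? ∘ (x ∷_)) xs
  ... | yes (σ , σ⊆ , p) = yes (x ∷ σ , refl ∷ σ⊆ , p)
  ... | no ¬keep with anySublist? P? xs
  ...   | yes (σ , σ⊆ , p) = yes (σ , skip x σ⊆ , p)
  ...   | no ¬skip = no λ { (_     , skip _ σ⊆   , p) → ¬skip (_ , σ⊆ , p)
                          ; (_ ∷ σ , refl ∷ σ⊆ , p) → ¬keep (σ , σ⊆ , p) }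

orderIsomorphic? : ∀ σ τ → Dec (OrderIsomorphic σ τ)
orderIsomorphic? σ τ with length σ ℕ.≟ length τ
... | no ≢ = no (≢ ∘ OrderIsomorphic.length-≡)
... | yes eq = map′
  (λ (l , e) → record { length-≡ = eq ; <-iff = l ; ≡-iff = e })
  (λ o → OrderIsomorphic.<-iff o , OrderIsomorphic.≡-iff o)
  ((Fin.all? λ i → Fin.all? λ j → (_ ℕ.<? _) ⇔-dec (_ ℕ.<? _)) ×-dec
   (Fin.all? λ i → Fin.all? λ j → (_ ℕ.≟ _) ⇔-dec (_ ℕ.≟ _)))

contains? : ∀ π τ → Dec (Contains π τ)
contains? π τ = anySublist? (λ σ → orderIsomorphic? σ τ) π

isRestrictedGrowth? : Decidable IsRestrictedGrowth
isRestrictedGrowth? π = map′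
  (λ (p , s , g) → record { positive = p ; starts = s ; growth = g })
  (λ r → let open IsRestrictedGrowth r in positive , starts , growth)
  (all? (1 ℕ.≤?_) π ×-dec
   Maybe.≡-dec ℕ._≟_ (head π) (just 1) ×-dec
   Fin.all? λ j → (1 ℕ.≤? toℕ j) →-dec (_ ℕ.≤? _))

_∈𝒫?[_,_] : ∀ π n B → Dec (π ∈𝒫[ n , B ])
π ∈𝒫?[ n , B ] = map′
  (λ (l , r , a) → mk l r a)
  (λ (mk l r a) → l , r , a)
  ((length π ℕ.≟ n) ×-dec isRestrictedGrowth? π ×-dec all? (¬? ∘ contains? π) B)

-- All sequences of length n over the alphabet {1, …, k}.
words : ℕ → ℕ → List (List ℕ)
words k zero    = [ [] ]
words k (suc n) = cartesianProductWith _∷_ (applyUpTo suc k) (words k n)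

-- A restricted growth sequence of length n has all its entries in {1, …, n}
-- (see ∈𝒫⇔), so it suffices to search there.
𝒫 : ℕ → List (List ℕ) → List (List ℕ)
𝒫 n B = filter (_∈𝒫?[ n , B ]) (words n n)

∣𝒫∣ : ℕ → List (List ℕ) → ℕ
∣𝒫∣ n B = length (𝒫 n B)

words-unique : ∀ k n → Unique (words k n)
words-unique k zero    = [] ∷ []
words-unique k (suc n) = Unique.cartesianProductWith⁺ _∷_ List.∷-injective
  (Unique.applyUpTo⁺₁ suc k (λ i<j _ → ℕ.<⇒≢ i<j ∘ ℕ.suc-injective))
  (words-unique k n)

𝒫-unique : ∀ n B → Unique (𝒫 n B)
𝒫-unique n B = Unique.filter⁺ (_∈𝒫?[ n , B ]) (words-unique n n)

private
  ∈-words : ∀ k π → All (1 ≤_) π → All (_≤ k) π → π ∈ words k (length π)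
  ∈-words k []          []         []         = here refl
  ∈-words k (suc x ∷ π) (_ ∷ pos) (x<k ∷ bnd) =
    ∈-cartesianProductWith⁺ _∷_ (∈-applyUpTo⁺ suc x<k) (∈-words k π pos bnd)

  take-≤ : ∀ {π} → IsRestrictedGrowth π → ∀ k → k ≤ length π → All (_≤ k) (take k π)
  take-≤     r zero    _   = []
  take-≤ {π} r (suc k) k<l =
    subst (All (_≤ suc k)) (trans (sym (List.take-suc π j)) (cong (λ m → take (suc m) π) j≡k))
      (subst (λ m → All (_≤ suc k) (take m π ∷ʳ lookup π j)) (sym j≡k)
        (All.∷ʳ⁺ (All.map ℕ.m≤n⇒m≤1+n ih) (bound π r k k<l ih)))
    where
    j   = Fin.fromℕ< k<l
    j≡k = Fin.toℕ-fromℕ< k<l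
    ih  = take-≤ r k (ℕ.<⇒≤ k<l)

    bound : ∀ π → IsRestrictedGrowth π → ∀ k (k<l : k < length π) → All (_≤ k) (take k π) →
            lookup π (Fin.fromℕ< k<l) ≤ suc k
    bound (x ∷ π) r zero    k<l _  with refl ← IsRestrictedGrowth.starts r = s≤s z≤n
    bound π       r (suc k) k<l ih =
      ℕ.≤-trans (IsRestrictedGrowth.growth r (Fin.fromℕ< k<l)
                  (subst (1 ≤_) (sym (Fin.toℕ-fromℕ< k<l)) (s≤s z≤n)))
                (s≤s (max≤v⁺ {xs = take (toℕ (Fin.fromℕ< k<l)) π} z≤n
                  (subst (λ m → All (_≤ suc k) (take m π)) (sym (Fin.toℕ-fromℕ< k<l)) ih)))

∈𝒫⇔ : ∀ {π n B} → π ∈ 𝒫 n B ⇔ π ∈𝒫[ n , B ]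
∈𝒫⇔ {π} {n} {B} = mk⇔
  (proj₂ ∘ ∈-filter⁻ (_∈𝒫?[ n , B ]) {xs = words n n})
  from
  where
  from : π ∈𝒫[ n , B ] → π ∈ 𝒫 n B
  from p@(mk refl r _) = ∈-filter⁺ (_∈𝒫?[ n , B ])
    (∈-words n π (IsRestrictedGrowth.positive r)
      (subst (All (_≤ n)) (List.take-all n π ℕ.≤-refl) (take-≤ r n ℕ.≤-refl)))
    p

12⋯_⟨1⟩ : ℕ → List ℕ
12⋯ ℓ ⟨1⟩ = applyUpTo suc ℓ ∷ʳ 1

-- Power series are coefficient sequences over ℤ.
PowerSeries : Set
PowerSeries = ℕ → ℤ

infix  4 _≈_
infixl 6 _+_ _-_
infixl 7 _*_ _/_
infixr 8 _^_

_≈_ : PowerSeries → PowerSeries → Set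
f ≈ g = ∀ n → f n ≡ g n

const : ℤ → PowerSeries
const c zero    = c
const c (suc _) = 0ℤ

x : PowerSeries
x 1 = 1ℤ
x _ = 0ℤ

_+_ _-_ _*_ : PowerSeries → PowerSeries → PowerSeries
(f + g) n = f n ℤ.+ g n
(f - g) n = f n ℤ.- g n
(f * g) n = ∑[ i ≤ n ] (f (toℕ i) ℤ.* g (n ∸ toℕ i))

_^_ : PowerSeries → ℕ → PowerSeries
f ^ zero  = const 1ℤ
f ^ suc n = f * f ^ n

-- Long division, meaningful for divisors with constant term 1; for these
-- f / g is the quotient in ℤ[[x]], by /-correct.
_/_ : PowerSeries → PowerSeries → PowerSeries
(f / g) zero    = f 0
(f / g) (suc n) = ((λ m → f (suc m) ℤ.- f 0 ℤ.* g (suc m)) / g) n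

/-correct : ∀ f g → g 0 ≡ 1ℤ → (f / g) * g ≈ f
/-correct f g g₀≡1 zero = begin
  f 0 ℤ.* g 0 ℤ.+ 0ℤ  ≡⟨ ℤ.+-identityʳ _ ⟩
  f 0 ℤ.* g 0         ≡⟨ cong (f 0 ℤ.*_) g₀≡1 ⟩
  f 0 ℤ.* 1ℤ          ≡⟨ ℤ.*-identityʳ _ ⟩
  f 0                 ∎
  where open ≡-Reasoning
/-correct f g g₀≡1 (suc n) = begin
  a ℤ.+ ((f′ / g) * g) n      ≡⟨ cong (λ b → a ℤ.+ b) (/-correct f′ g g₀≡1 n) ⟩
  a ℤ.+ (f (suc n) ℤ.- a)     ≡⟨ ℤ.+-comm a _ ⟩
  f (suc n) ℤ.- a ℤ.+ a       ≡⟨ ℤ.+-assoc (f (suc n)) (ℤ.- a) a ⟩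
  f (suc n) ℤ.+ (ℤ.- a ℤ.+ a) ≡⟨ cong (λ b → f (suc n) ℤ.+ b) (ℤ.+-inverseˡ a) ⟩
  f (suc n) ℤ.+ 0ℤ            ≡⟨ ℤ.+-identityʳ _ ⟩
  f (suc n)                   ∎
  where
  open ≡-Reasoning
  a  = f 0 ℤ.* g (suc n)
  f′ : PowerSeries
  f′ m = f (suc m) ℤ.- f 0 ℤ.* g (suc m)

Sum Prod : ℕ → (ℕ → PowerSeries) → PowerSeries
Sum  zero    f = const 0ℤ
Sum  (suc n) f = Sum n f + f (suc n)
Prod zero    f = const 1ℤ
Prod (suc n) f = Prod n f * f (suc n)

infix 5 Sum Prod
syntax Sum  n (λ i → f) = Σ[ i ∈1⋯ n ] f
syntax Prod n (λ i → f) = Π[ i ∈1⋯ n ] f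

1-_·x : ℕ → PowerSeries
1- j ·x = const 1ℤ - const (+ j) * x

Π₀≡1 : ∀ n → (Π[ j ∈1⋯ n ] 1- j ·x) 0 ≡ 1ℤ
Π₀≡1 zero    = refl
Π₀≡1 (suc n) = begin
  (Π[ j ∈1⋯ n ] 1- j ·x) 0 ℤ.* (1- suc n ·x) 0 ℤ.+ 0ℤ ≡⟨ ℤ.+-identityʳ _ ⟩
  (Π[ j ∈1⋯ n ] 1- j ·x) 0 ℤ.* (1- suc n ·x) 0        ≡⟨ cong₂ ℤ._*_ (Π₀≡1 n) (c (suc n)) ⟩
  1ℤ                                                ∎
  where
  open ≡-Reasoning
  c : ∀ j → (1- j ·x) 0 ≡ 1ℤ
  c j = cong (λ b → 1ℤ ℤ.- b) (trans (ℤ.+-identityʳ _) (ℤ.*-zeroʳ (+ j)))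

-- Σ_{n ≥ 1} a_n xⁿ
generatingFunction : (ℕ → ℕ) → PowerSeries
generatingFunction a zero    = 0ℤ
generatingFunction a (suc n) = + a (suc n)

{-# OPTIONS --safe #-}
module Submission where

-- Write ℓ = r + 1. In a restricted growth sequence whose maximum so far is m,
-- the letters 1, …, m have already occurred, first occurrences in increasing
-- order. If the next letter is y with y + r ≤ m, then y, y + 1, …, y + r, y is
-- a copy of 12⋯ℓ1; conversely, in a copy of 12⋯ℓ1 the last letter lies at
-- least r below the letter before it, hence below the maximum so far. So the sequence avoids 12⋯ℓ1 iff every
-- letter y, read when the maximum so far is m, satisfies m < y + r. The
-- avoiders are therefore the walks (`Walk`) on the states m = 0, 1, 2, … that
-- start in 0 and at each step either stay in m, in min(m, r) ways, or move to
-- m + 1, in one way (`∈𝒫⇔walk`, `∣𝒫∣≡#walks`).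
--
-- Let C_m be the generating function of walks starting in state m, counted by
-- length. The wanted series is x C_1, and C_m (1 - mx) = 1 + x C_{m+1} for
-- m ≤ r (`walkSeries-rec`). Substituting these equations into one another
-- for m = 1, …, r - 1 gives (`unroll-recurrence`)
--
--   x C_1 = Σ_{i=1}^{r-1} x^i / Π_{j≤i} (1 - jx) + x^r C_r / Π_{j≤r-1} (1 - jx).
--
-- From state r on, the number of walks no longer depends on the state, so
-- C_{r+1} = C_r = 1 / (1 - (r+1)x). This turns the last summand into
-- x^r (1 - rx) / Π_{j≤r+1} (1 - jx) (`remainder`).

open import Defs
open import Data.Fin.Base as Fin using (Fin; toℕ; fromℕ<; cast)
import Data.Fin.Properties as Fin
open import Data.Integer.Base as ℤ using (ℤ; +_; 0ℤ; 1ℤ)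
import Data.Integer.Properties as ℤ
open import Data.Integer.Tactic.RingSolver using (solve-∀)
open import Data.List.Base
  using (List; []; _∷_; [_]; _++_; _∷ʳ_; length; lookup; take; map; applyUpTo; cartesianProductWith)
open import Data.List.Extrema.Nat using (max; max≤v⁺; ⊥≤max; xs≤max)
open import Data.List.Membership.Propositional using (_∈_)
open import Data.List.Membership.Propositional.Properties
  using (∈-lookup; ∈-applyUpTo⁺; ∈-applyUpTo⁻; ∈-++⁺ˡ; ∈-++⁺ʳ; ∈-++⁻; ∈-map⁺; ∈-map⁻;
         ∈-cartesianProductWith⁺; ∈-cartesianProductWith⁻)
open import Data.List.Membership.Propositional.Properties.WithK using (unique∧set⇒bag)
import Data.List.Properties as List
open import Data.List.Relation.Binary.BagAndSetEquality using (∼bag⇒↭)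
open import Data.List.Relation.Binary.Disjoint.Propositional using (Disjoint)
open import Data.List.Relation.Binary.Permutation.Propositional.Properties using (↭-length)
open import Data.List.Relation.Binary.Sublist.Propositional
  using (_⊆_; []; _∷_; ⊆-refl; ⊆-trans; to∈; from∈; minimum) renaming (_∷ʳ_ to skip)
import Data.List.Relation.Binary.Sublist.Propositional.Properties as Sublist
open import Data.List.Relation.Unary.All as All using (All; []; _∷_)
open import Data.List.Relation.Unary.Any using (here; there)
open import Data.List.Relation.Unary.Unique.Propositional using (Unique; []; _∷_)
import Data.List.Relation.Unary.Unique.Propositional.Properties as Unique
open import Data.Maybe.Base using (just)
open import Data.Nat.Base as ℕ using (ℕ; zero; suc; _≤_; _<_; _∸_; _⊔_; _⊓_; z≤n; s≤s)
import Data.Nat.Properties as ℕ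
open import Data.Product.Base using (∃-syntax; _×_; _,_; proj₁; proj₂)
open import Data.Sum.Base using (inj₁; inj₂)
open import Function.Base using (_∘_)
open import Function.Bundles using (_⇔_; mk⇔; Equivalence)
open import Relation.Binary.PropositionalEquality
  using (_≡_; refl; sym; trans; cong; cong₂; subst; subst₂; _→-setoid_; module ≡-Reasoning)
import Relation.Binary.Reasoning.Setoid (ℕ →-setoid ℤ) as ≈-Reasoning

-- Occurrences of the pattern 12⋯ℓ1

lookup-map : ∀ (f : ℕ → ℕ) xs i → lookup (map f xs) i ≡ f (lookup xs (cast (List.length-map f xs) i))
lookup-map f (x ∷ xs) Fin.zero    = refl
lookup-map f (x ∷ xs) (Fin.suc i) = lookup-map f xs i

strictlyMonotone⇒orderIsomorphic : ∀ {f : ℕ → ℕ} → (∀ {a b} → a < b ⇔ f a < f b) →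
  (∀ {a b} → f a ≡ f b → a ≡ b) → ∀ τ → OrderIsomorphic (map f τ) τ
strictlyMonotone⇒orderIsomorphic {f} <⇔ inj τ = record
  { length-≡ = List.length-map f τ
  ; <-iff    = λ i j → mk⇔
      (λ lt → Equivalence.from <⇔ (subst₂ _<_ (lookup-map f τ i) (lookup-map f τ j) lt))
      (λ lt → subst₂ _<_ (sym (lookup-map f τ i)) (sym (lookup-map f τ j)) (Equivalence.to <⇔ lt))
  ; ≡-iff    = λ i j → mk⇔
      (λ eq → inj (trans (sym (lookup-map f τ i)) (trans eq (lookup-map f τ j))))
      (λ eq → trans (lookup-map f τ i) (trans (cong f eq) (sym (lookup-map f τ j))))
  }

shift-orderIsomorphic : ∀ a τ → OrderIsomorphic (map (a ℕ.+_) τ) τ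
shift-orderIsomorphic a = strictlyMonotone⇒orderIsomorphic
  (mk⇔ (ℕ.+-monoʳ-< a) (ℕ.+-cancelˡ-< a _ _)) (ℕ.+-cancelˡ-≡ a _ _)

-- If g is f shifted by a, then g 0, …, g (n-1) is a contiguous block of
-- f 0, …, f (m-1) as soon as a + n ≤ m.
applyUpTo-⊆ : ∀ {f g : ℕ → ℕ} {a n m} → (∀ i → g i ≡ f (a ℕ.+ i)) → a ℕ.+ n ≤ m →
              applyUpTo g n ⊆ applyUpTo f m
applyUpTo-⊆ {a = zero}  {n = zero}  g≗f _       = minimum _
applyUpTo-⊆ {a = zero}  {n = suc n} g≗f (s≤s h) = g≗f 0 ∷ applyUpTo-⊆ (g≗f ∘ suc) h
applyUpTo-⊆ {f = f} {a = suc a}     g≗f (s≤s h) = skip (f 0) (applyUpTo-⊆ {a = a} g≗f h)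

-- A prefix p containing 1, …, m in order, followed by y = a + 1 with
-- y + r ≤ m, yields the copy y, y + 1, …, y + r, y of 12⋯ℓ1.
repeat⇒contains : ∀ {r m p} a w → applyUpTo suc m ⊆ p → a ℕ.+ suc r ≤ m →
                  Contains (p ++ suc a ∷ w) (12⋯ suc r ⟨1⟩)
repeat⇒contains {r} {m} {p} a w 1⋯m⊆p a+r<m =
  map (a ℕ.+_) (12⋯ suc r ⟨1⟩) ,
  subst (_⊆ p ++ suc a ∷ w) (sym shifted)
    (Sublist.++⁺ (⊆-trans (applyUpTo-⊆ (ℕ.+-suc a) a+r<m) 1⋯m⊆p) (ℕ.+-comm a 1 ∷ minimum w)) ,
  shift-orderIsomorphic a (12⋯ suc r ⟨1⟩)
  where
  shifted : map (a ℕ.+_) (12⋯ suc r ⟨1⟩) ≡ applyUpTo (λ i → a ℕ.+ suc i) (suc r) ∷ʳ (a ℕ.+ 1)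
  shifted = trans (List.map-++ (a ℕ.+_) (applyUpTo suc (suc r)) [ 1 ])
                  (cong (_∷ʳ (a ℕ.+ 1)) (List.map-applyUpTo suc (a ℕ.+_) (suc r)))

lookup-applyUpTo-∷ʳ : ∀ (f : ℕ → ℕ) n y i → toℕ i < n → lookup (applyUpTo f n ∷ʳ y) i ≡ f (toℕ i)
lookup-applyUpTo-∷ʳ f (suc n) y Fin.zero    _       = refl
lookup-applyUpTo-∷ʳ f (suc n) y (Fin.suc i) (s≤s h) = lookup-applyUpTo-∷ʳ (f ∘ suc) n y i h

lookup-applyUpTo-∷ʳ-last : ∀ (f : ℕ → ℕ) n y i → toℕ i ≡ n → lookup (applyUpTo f n ∷ʳ y) i ≡ y
lookup-applyUpTo-∷ʳ-last f zero    y Fin.zero    _  = refl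
lookup-applyUpTo-∷ʳ-last f (suc n) y (Fin.suc i) eq =
  lookup-applyUpTo-∷ʳ-last (f ∘ suc) n y i (ℕ.suc-injective eq)

lookup-pair-⊆ : ∀ (xs : List ℕ) i j → toℕ i < toℕ j → lookup xs i ∷ lookup xs j ∷ [] ⊆ xs
lookup-pair-⊆ (x ∷ xs) Fin.zero    (Fin.suc j) _       = refl ∷ from∈ (∈-lookup j)
lookup-pair-⊆ (x ∷ xs) (Fin.suc i) (Fin.suc j) (s≤s h) = skip x (lookup-pair-⊆ xs i j h)

-- In a copy of 12⋯ℓ1, with ℓ = r + 1, the letter b at the end is equal to the
-- first one, and the letter a before it is reached from there by r strict
-- increases; hence b + r ≤ a.
orderIsomorphic⇒drop : ∀ {r σ} → OrderIsomorphic σ (12⋯ suc r ⟨1⟩) →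
                       ∃[ a ] ∃[ b ] (a ∷ b ∷ [] ⊆ σ) × b ℕ.+ r ≤ a
orderIsomorphic⇒drop {r} {σ} o =
  at r , at (suc r) ,
  lookup-pair-⊆ σ (pos r) (pos (suc r))
    (subst₂ _<_ (sym (toℕ-pos (ℕ.n≤1+n r))) (sym (toℕ-pos ℕ.≤-refl)) ℕ.≤-refl) ,
  subst (λ b → b ℕ.+ r ≤ at r) first≡last (climb r ℕ.≤-refl)
  where
  open OrderIsomorphic o
  τ : List ℕ
  τ = 12⋯ suc r ⟨1⟩

  length-σ : length σ ≡ suc (suc r)
  length-σ = trans length-≡ (trans (List.length-++ (applyUpTo suc (suc r)))
    (trans (cong (ℕ._+ 1) (List.length-applyUpTo suc (suc r))) (ℕ.+-comm (suc r) 1)))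

  -- The k-th position of σ, counted from 0. For k beyond the last index
  -- r + 1 this is the last position.
  pos : ℕ → Fin (length σ)
  pos k = cast (sym length-σ) (fromℕ< (s≤s (ℕ.m⊓n≤n k (suc r))))

  toℕ-pos : ∀ {k} → k ≤ suc r → toℕ (pos k) ≡ k
  toℕ-pos {k} k≤ = trans (Fin.toℕ-cast (sym length-σ) (fromℕ< (s≤s (ℕ.m⊓n≤n k (suc r)))))
    (trans (Fin.toℕ-fromℕ< _) (ℕ.m≤n⇒m⊓n≡m k≤))

  at : ℕ → ℕ
  at k = lookup σ (pos k)

  toℕ-cast-pos : ∀ {k} → k ≤ suc r → toℕ (cast length-≡ (pos k)) ≡ k
  toℕ-cast-pos k≤ = trans (Fin.toℕ-cast length-≡ _) (toℕ-pos k≤)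

  τ-at : ∀ {k} → k ≤ r → lookup τ (cast length-≡ (pos k)) ≡ suc k
  τ-at {k} k≤r = trans
    (lookup-applyUpTo-∷ʳ suc (suc r) 1 _ (subst (_< suc r) (sym toℕ≡k) (s≤s k≤r)))
    (cong suc toℕ≡k)
    where
    toℕ≡k = toℕ-cast-pos (ℕ.m≤n⇒m≤1+n k≤r)

  first≡last : at 0 ≡ at (suc r)
  first≡last = Equivalence.from (≡-iff (pos 0) (pos (suc r))) (trans (τ-at z≤n)
    (sym (lookup-applyUpTo-∷ʳ-last suc (suc r) 1 _ (toℕ-cast-pos ℕ.≤-refl))))

  climb : ∀ k → k ≤ r → at 0 ℕ.+ k ≤ at k
  climb zero    _   = ℕ.≤-reflexive (ℕ.+-identityʳ _)
  climb (suc k) k<r = ℕ.≤-trans (ℕ.≤-reflexive (ℕ.+-suc (at 0) k))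
    (ℕ.≤-<-trans (climb k (ℕ.<⇒≤ k<r)) (Equivalence.from (<-iff (pos k) (pos (suc k)))
      (subst₂ _<_ (sym (τ-at (ℕ.<⇒≤ k<r))) (sym (τ-at k<r)) ℕ.≤-refl)))

-- Avoiders as walks

-- `Walk r m w`: every letter y of w, read when the maximum of the letters
-- before it is m′ (with m as the maximum at the start), is positive, at most
-- 1 + m′, and within the window m′ < y + r.
data Walk (r : ℕ) : ℕ → List ℕ → Set where
  []   : ∀ {m} → Walk r m []
  step : ∀ {m y w} → 1 ≤ y → y ≤ suc m → m < y ℕ.+ r →
         Walk r (m ⊔ y) w → Walk r m (y ∷ w)

-- The running maximum never decreases, so the window condition at the moment
-- b is read also holds with respect to any earlier maximum.
walk-∈ : ∀ {r m b w} → Walk r m w → b ∈ w → m < b ℕ.+ r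
walk-∈ (step _ _ m<y+r _) (here refl) = m<y+r
walk-∈ (step _ _ _ W)     (there b∈w) = ℕ.≤-<-trans (ℕ.m≤m⊔n _ _) (walk-∈ W b∈w)

walk-drop< : ∀ {r m a b w} → Walk r m w → a ∷ b ∷ [] ⊆ w → a < b ℕ.+ r
walk-drop< (step _ _ _ W)         (skip _ ab⊆w)  = walk-drop< W ab⊆w
walk-drop< (step {m = m} _ _ _ W) (refl ∷ b⊆w) = ℕ.≤-<-trans (ℕ.m≤n⊔m m _) (walk-∈ W (to∈ b⊆w))

walk⇒avoids : ∀ {r m w} → Walk r m w → Avoids w (12⋯ suc r ⟨1⟩)
walk⇒avoids W (σ , σ⊆w , o) with _ , _ , ab⊆σ , b+r≤a ← orderIsomorphic⇒drop o =
  ℕ.<⇒≱ (walk-drop< W (⊆-trans ab⊆σ σ⊆w)) b+r≤a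

max-⊔ : ∀ m y xs → max (m ⊔ y) xs ≡ max m (y ∷ xs)
max-⊔ m y xs = ℕ.≤-antisym
  (max≤v⁺ (ℕ.⊔-lub (⊥≤max m (y ∷ xs)) (All.head (xs≤max m (y ∷ xs)))) (All.tail (xs≤max m (y ∷ xs))))
  (max≤v⁺ (ℕ.≤-trans (ℕ.m≤m⊔n m y) (⊥≤max (m ⊔ y) xs))
          (ℕ.≤-trans (ℕ.m≤n⊔m m y) (⊥≤max (m ⊔ y) xs) ∷ xs≤max (m ⊔ y) xs))

-- The growth condition for a word that is read when the maximum so far is m.
-- With m = 0 it covers the first letter too, forcing it to be at most 1.
Growing : ℕ → List ℕ → Set
Growing m w = ∀ (j : Fin (length w)) → lookup w j ≤ suc (max m (take (toℕ j) w))

walk⇒growing : ∀ {r m w} → Walk r m w → Growing m w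
walk⇒growing (step _ y≤1+m _ W) Fin.zero    = y≤1+m
walk⇒growing (step {m} {y} {w} _ _ _ W) (Fin.suc j) =
  subst (λ k → lookup w j ≤ suc k) (max-⊔ m y (take (toℕ j) w)) (walk⇒growing W j)

walk⇒positive : ∀ {r m w} → Walk r m w → All (1 ≤_) w
walk⇒positive []               = []
walk⇒positive (step 1≤y _ _ W) = 1≤y ∷ walk⇒positive W

walk⇒restrictedGrowth : ∀ {r y w} → Walk r 0 (y ∷ w) → IsRestrictedGrowth (y ∷ w)
walk⇒restrictedGrowth W@(step 1≤y y≤1 _ _) = record
  { positive = walk⇒positive W
  ; starts   = cong just (ℕ.≤-antisym y≤1 1≤y)
  ; growth   = λ j _ → walk⇒growing W j
  }

restrictedGrowth⇒growing : ∀ {π} → IsRestrictedGrowth π → Growing 0 π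
restrictedGrowth⇒growing {_ ∷ _} g Fin.zero with refl ← IsRestrictedGrowth.starts g = ℕ.≤-refl
restrictedGrowth⇒growing {_ ∷ _} g (Fin.suc j) = IsRestrictedGrowth.growth g (Fin.suc j) (s≤s z≤n)

extend-1⋯m : ∀ {m y p} → applyUpTo suc m ⊆ p → y ≤ suc m → applyUpTo suc (m ⊔ y) ⊆ p ∷ʳ y
extend-1⋯m {m} {y} {p} 1⋯m⊆p y≤1+m with ℕ.m≤n⇒m<n∨m≡n y≤1+m
... | inj₁ (s≤s y≤m) = subst (λ k → applyUpTo suc k ⊆ p ∷ʳ y) (sym (ℕ.m≥n⇒m⊔n≡m y≤m))
                         (Sublist.++⁺ʳ [ y ] 1⋯m⊆p)
... | inj₂ refl      = subst (_⊆ p ∷ʳ y)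
                         (trans (List.applyUpTo-∷ʳ suc m)
                                (cong (applyUpTo suc) (sym (ℕ.m≤n⇒m⊔n≡n (ℕ.n≤1+n m)))))
                         (Sublist.++⁺ 1⋯m⊆p ⊆-refl)

-- The word w is read after the prefix p, with m as the maximum so far; about
-- p it only matters that 1, …, m occur in it in order.
growing⇒walk : ∀ {r m} p w → applyUpTo suc m ⊆ p → All (1 ≤_) w → Growing m w →
               Avoids (p ++ w) (12⋯ suc r ⟨1⟩) → Walk r m w
growing⇒walk p [] _ _ _ _ = []
growing⇒walk {r} {m} p (y@(suc a) ∷ w) 1⋯m⊆p (1≤y ∷ pos) grows avoids =
  step 1≤y (grows Fin.zero) m<y+r
    (growing⇒walk (p ∷ʳ y) w (extend-1⋯m 1⋯m⊆p (grows Fin.zero)) pos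
      (λ j → subst (λ k → lookup w j ≤ suc k) (sym (max-⊔ m y (take (toℕ j) w))) (grows (Fin.suc j)))
      (subst (λ π → Avoids π (12⋯ suc r ⟨1⟩)) (sym (List.∷ʳ-++ p y w)) avoids))
  where
  m<y+r : m < y ℕ.+ r
  m<y+r = ℕ.≰⇒> λ y+r≤m → avoids (repeat⇒contains a w 1⋯m⊆p
            (subst (_≤ m) (sym (ℕ.+-suc a r)) y+r≤m))

-- The length is positive because the empty word is a walk but not a
-- restricted growth sequence.
∈𝒫⇔walk : ∀ {r n π} → π ∈𝒫[ suc n , [ 12⋯ suc r ⟨1⟩ ] ] ⇔ (length π ≡ suc n × Walk r 0 π)
∈𝒫⇔walk = mk⇔
  (λ { (mk len g (av ∷ [])) → len ,
     growing⇒walk [] _ [] (IsRestrictedGrowth.positive g) (restrictedGrowth⇒growing g) av })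
  (λ { (len , W@(step _ _ _ _)) → mk len (walk⇒restrictedGrowth W) (walk⇒avoids W ∷ []) })

-- Counting walks

-- The letters that leave the maximum m unchanged: m, m - 1, …, one for each
-- i < min(m, r).
oldLetters : ℕ → ℕ → List ℕ
oldLetters r m = applyUpTo (m ∸_) (m ⊓ r)

∈-oldLetters : ∀ {r m y} → y ∈ oldLetters r m ⇔ (1 ≤ y × y ≤ m × m < y ℕ.+ r)
∈-oldLetters {r} {m} {y} = mk⇔ to from
  where
  to : y ∈ oldLetters r m → 1 ≤ y × y ≤ m × m < y ℕ.+ r
  to y∈ with i , i<m⊓r , refl ← ∈-applyUpTo⁻ (m ∸_) y∈ =
    ℕ.m<n⇒0<n∸m i<m , ℕ.m∸n≤m m i ,
    subst (_< m ∸ i ℕ.+ r) (ℕ.m∸n+n≡m (ℕ.<⇒≤ i<m))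
      (ℕ.+-monoʳ-< (m ∸ i) (ℕ.<-≤-trans i<m⊓r (ℕ.m⊓n≤n m r)))
    where
    i<m : i < m
    i<m = ℕ.<-≤-trans i<m⊓r (ℕ.m⊓n≤m m r)
  from : 1 ≤ y × y ≤ m × m < y ℕ.+ r → y ∈ oldLetters r m
  from (1≤y , y≤m , m<y+r) = subst (_∈ oldLetters r m) (ℕ.m∸[m∸n]≡n y≤m)
    (∈-applyUpTo⁺ (m ∸_) (ℕ.⊓-pres-m<
      (ℕ.∸-monoʳ-< 1≤y y≤m)
      (subst (m ∸ y <_) (ℕ.m+n∸m≡n y r) (ℕ.∸-monoˡ-< m<y+r y≤m))))

oldLetters-unique : ∀ r m → Unique (oldLetters r m)
oldLetters-unique r m = Unique.applyUpTo⁺₁ (m ∸_) (m ⊓ r) λ i<j j<m⊓r eq →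
  ℕ.<⇒≢ (ℕ.∸-monoʳ-< i<j (ℕ.<⇒≤ (ℕ.<-≤-trans j<m⊓r (ℕ.m⊓n≤m m r)))) (sym eq)

-- All walks of length n starting with maximum m, sorted by whether the first
-- letter is an old one or the new maximum m + 1.
walks : ℕ → ℕ → ℕ → List (List ℕ)
walks r zero    m = [ [] ]
walks r (suc n) m = cartesianProductWith _∷_ (oldLetters r m) (walks r n m)
                    ++ map (suc m ∷_) (walks r n (suc m))

∈-walks⁻ : ∀ {r} n {m w} → w ∈ walks r n m → length w ≡ n × Walk r m w
∈-walks⁻ zero (here refl) = refl , []
∈-walks⁻ {r} (suc n) {m} w∈ with ∈-++⁻ (cartesianProductWith _∷_ (oldLetters r m) (walks r n m)) w∈
... | inj₁ w∈old
  with y , w , y∈ , w∈ , refl ← ∈-cartesianProductWith⁻ _∷_ (oldLetters r m) (walks r n m) w∈old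
  with 1≤y , y≤m , m<y+r ← Equivalence.to (∈-oldLetters {r}) y∈
  with len , W ← ∈-walks⁻ n w∈
  = cong suc len , step 1≤y (ℕ.m≤n⇒m≤1+n y≤m) m<y+r
      (subst (λ k → Walk r k w) (sym (ℕ.m≥n⇒m⊔n≡m y≤m)) W)
... | inj₂ w∈new with w , w∈ , refl ← ∈-map⁻ (suc m ∷_) w∈new
  with len , W ← ∈-walks⁻ n w∈
  = cong suc len , step (s≤s z≤n) ℕ.≤-refl (s≤s (ℕ.m≤m+n m r))
      (subst (λ k → Walk r k w) (sym (ℕ.m≤n⇒m⊔n≡n (ℕ.n≤1+n m))) W)

∈-walks⁺ : ∀ {r m w} → Walk r m w → w ∈ walks r (length w) m
∈-walks⁺ [] = here refl
∈-walks⁺ {r} {m} (step {w = w} 1≤y y≤1+m m<y+r W) with ℕ.m≤n⇒m<n∨m≡n y≤1+m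
... | inj₁ (s≤s y≤m) = ∈-++⁺ˡ (∈-cartesianProductWith⁺ _∷_
        (Equivalence.from (∈-oldLetters {r}) (1≤y , y≤m , m<y+r))
        (∈-walks⁺ (subst (λ k → Walk r k w) (ℕ.m≥n⇒m⊔n≡m y≤m) W)))
... | inj₂ refl = ∈-++⁺ʳ (cartesianProductWith _∷_ (oldLetters r m) (walks r (length w) m))
        (∈-map⁺ (suc m ∷_) (∈-walks⁺ (subst (λ k → Walk r k w) (ℕ.m≤n⇒m⊔n≡n (ℕ.n≤1+n m)) W)))

walks-unique : ∀ r n m → Unique (walks r n m)
walks-unique r zero    m = [] ∷ []
walks-unique r (suc n) m = Unique.++⁺
  (Unique.cartesianProductWith⁺ _∷_ List.∷-injective (oldLetters-unique r m) (walks-unique r n m))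
  (Unique.map⁺ List.∷-injectiveʳ (walks-unique r n (suc m)))
  disjoint
  where
  disjoint : Disjoint (cartesianProductWith _∷_ (oldLetters r m) (walks r n m))
                      (map (suc m ∷_) (walks r n (suc m)))
  disjoint (w∈old , w∈new)
    with _ , _ , y∈ , _ , refl ← ∈-cartesianProductWith⁻ _∷_ (oldLetters r m) (walks r n m) w∈old
    with _ , _ , refl ← ∈-map⁻ (suc m ∷_) w∈new
    = ℕ.1+n≰n (proj₁ (proj₂ (Equivalence.to (∈-oldLetters {r}) y∈)))

#walks : ℕ → ℕ → ℕ → ℕ
#walks r n m = length (walks r n m)

length-cartesianProductWith : ∀ {A B C : Set} (f : A → B → C) xs ys →
  length (cartesianProductWith f xs ys) ≡ length xs ℕ.* length ys
length-cartesianProductWith f []       ys = refl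
length-cartesianProductWith f (x ∷ xs) ys = trans (List.length-++ (map (f x) ys))
  (cong₂ ℕ._+_ (List.length-map (f x) ys) (length-cartesianProductWith f xs ys))

#walks-suc : ∀ r n m → #walks r (suc n) m ≡ (m ⊓ r) ℕ.* #walks r n m ℕ.+ #walks r n (suc m)
#walks-suc r n m = trans
  (List.length-++ (cartesianProductWith _∷_ (oldLetters r m) (walks r n m)))
  (cong₂ ℕ._+_
    (trans (length-cartesianProductWith _∷_ (oldLetters r m) (walks r n m))
           (cong (ℕ._* #walks r n m) (List.length-applyUpTo (m ∸_) (m ⊓ r))))
    (List.length-map (suc m ∷_) (walks r n (suc m))))

∣𝒫∣≡#walks : ∀ r n → ∣𝒫∣ (suc n) [ 12⋯ suc r ⟨1⟩ ] ≡ #walks r (suc n) 0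
∣𝒫∣≡#walks r n = ↭-length (∼bag⇒↭ (unique∧set⇒bag
  (𝒫-unique (suc n) B) (walks-unique r (suc n) 0) λ {π} → mk⇔ to (from {π})))
  where
  B = [ 12⋯ suc r ⟨1⟩ ]
  to : ∀ {π} → π ∈ 𝒫 (suc n) B → π ∈ walks r (suc n) 0
  to {π} π∈ with len , W ← Equivalence.to ∈𝒫⇔walk (Equivalence.to (∈𝒫⇔ {π} {suc n} {B}) π∈) =
    subst (λ k → π ∈ walks r k 0) len (∈-walks⁺ W)
  from : ∀ {π} → π ∈ walks r (suc n) 0 → π ∈ 𝒫 (suc n) B
  from π∈ = Equivalence.from ∈𝒫⇔ (Equivalence.from ∈𝒫⇔walk (∈-walks⁻ (suc n) π∈))

-- Once m ≥ r every state has exactly r old letters, so the count no longer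
-- depends on the state.
#walks-saturated : ∀ r n m → r ≤ m → #walks r n (suc m) ≡ #walks r n m
#walks-saturated r zero    m r≤m = refl
#walks-saturated r (suc n) m r≤m = begin
  #walks r (suc n) (suc m)
    ≡⟨ #walks-suc r n (suc m) ⟩
  (suc m ⊓ r) ℕ.* #walks r n (suc m) ℕ.+ #walks r n (suc (suc m))
    ≡⟨ cong₂ ℕ._+_
         (cong₂ ℕ._*_ (trans (ℕ.m≥n⇒m⊓n≡n (ℕ.m≤n⇒m≤1+n r≤m)) (sym (ℕ.m≥n⇒m⊓n≡n r≤m)))
                      (#walks-saturated r n m r≤m))
         (#walks-saturated r n (suc m) (ℕ.m≤n⇒m≤1+n r≤m)) ⟩
  (m ⊓ r) ℕ.* #walks r n m ℕ.+ #walks r n (suc m)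
    ≡⟨ #walks-suc r n m ⟨
  #walks r (suc n) m ∎
  where open ≡-Reasoning

-- Arithmetic of power series

-- The series (f - f 0) / x. By definition of the Cauchy product,
-- (f * g) (suc n) is f 0 * g (suc n) + (tail f * g) n, and the proofs about
-- products go by induction along this equation.
tail : PowerSeries → PowerSeries
tail f n = f (suc n)

-- Multiplication by a constant.
infixr 7 _·_
_·_ : ℤ → PowerSeries → PowerSeries
(c · f) n = c ℤ.* f n

+-cong : ∀ {f f′ g g′} → f ≈ f′ → g ≈ g′ → f + g ≈ f′ + g′
+-cong f≈f′ g≈g′ n = cong₂ ℤ._+_ (f≈f′ n) (g≈g′ n)

*-cong : ∀ {f f′ g g′} → f ≈ f′ → g ≈ g′ → f * g ≈ f′ * g′
*-cong f≈f′ g≈g′ zero    = cong₂ (λ a b → a ℤ.* b ℤ.+ 0ℤ) (f≈f′ 0) (g≈g′ 0)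
*-cong f≈f′ g≈g′ (suc n) =
  cong₂ ℤ._+_ (cong₂ ℤ._*_ (f≈f′ 0) (g≈g′ (suc n))) (*-cong (λ m → f≈f′ (suc m)) g≈g′ n)

*-congˡ : ∀ f {g g′} → g ≈ g′ → f * g ≈ f * g′
*-congˡ f = *-cong {f} (λ _ → refl)

*-congʳ : ∀ g {f f′} → f ≈ f′ → f * g ≈ f′ * g
*-congʳ g f≈f′ = *-cong {g = g} f≈f′ (λ _ → refl)

*-zeroˡ : ∀ g → (λ _ → 0ℤ) * g ≈ (λ _ → 0ℤ)
*-zeroˡ g zero    = refl
*-zeroˡ g (suc n) = trans (ℤ.+-identityˡ _) (*-zeroˡ g n)

*-identityˡ : ∀ g → const 1ℤ * g ≈ g
*-identityˡ g zero    = trans (ℤ.+-identityʳ _) (ℤ.*-identityˡ _)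
*-identityˡ g (suc n) =
  trans (cong₂ ℤ._+_ (ℤ.*-identityˡ (g (suc n))) (*-zeroˡ g n)) (ℤ.+-identityʳ _)

*-identityʳ : ∀ f → f * const 1ℤ ≈ f
*-identityʳ f zero    = trans (ℤ.+-identityʳ _) (ℤ.*-identityʳ _)
*-identityʳ f (suc n) =
  trans (cong₂ ℤ._+_ (ℤ.*-zeroʳ (f 0)) (*-identityʳ (tail f) n)) (ℤ.+-identityˡ _)

·-*-assoc : ∀ c f g → (c · f) * g ≈ c · (f * g)
·-*-assoc c f g zero    = lemma c (f 0) (g 0)
  where
  lemma : ∀ c a b → c ℤ.* a ℤ.* b ℤ.+ 0ℤ ≡ c ℤ.* (a ℤ.* b ℤ.+ 0ℤ)
  lemma = solve-∀
·-*-assoc c f g (suc n) =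
  trans (cong (λ t → c ℤ.* f 0 ℤ.* g (suc n) ℤ.+ t) (·-*-assoc c (tail f) g n))
        (lemma c (f 0) (g (suc n)) ((tail f * g) n))
  where
  lemma : ∀ c a b t → c ℤ.* a ℤ.* b ℤ.+ c ℤ.* t ≡ c ℤ.* (a ℤ.* b ℤ.+ t)
  lemma = solve-∀

*-distribʳ-+ : ∀ h f g → (f + g) * h ≈ f * h + g * h
*-distribʳ-+ h f g zero    = lemma (f 0) (g 0) (h 0)
  where
  lemma : ∀ a b c → (a ℤ.+ b) ℤ.* c ℤ.+ 0ℤ ≡ (a ℤ.* c ℤ.+ 0ℤ) ℤ.+ (b ℤ.* c ℤ.+ 0ℤ)
  lemma = solve-∀
*-distribʳ-+ h f g (suc n) =
  trans (cong (λ t → (f 0 ℤ.+ g 0) ℤ.* h (suc n) ℤ.+ t) (*-distribʳ-+ h (tail f) (tail g) n))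
        (lemma (f 0) (g 0) (h (suc n)) ((tail f * h) n) ((tail g * h) n))
  where
  lemma : ∀ a b c d e →
          (a ℤ.+ b) ℤ.* c ℤ.+ (d ℤ.+ e) ≡ (a ℤ.* c ℤ.+ d) ℤ.+ (b ℤ.* c ℤ.+ e)
  lemma = solve-∀

*-distribˡ-+ : ∀ f g h → f * (g + h) ≈ f * g + f * h
*-distribˡ-+ f g h zero    = lemma (f 0) (g 0) (h 0)
  where
  lemma : ∀ a b c → a ℤ.* (b ℤ.+ c) ℤ.+ 0ℤ ≡ (a ℤ.* b ℤ.+ 0ℤ) ℤ.+ (a ℤ.* c ℤ.+ 0ℤ)
  lemma = solve-∀
*-distribˡ-+ f g h (suc n) =
  trans (cong (λ t → f 0 ℤ.* (g (suc n) ℤ.+ h (suc n)) ℤ.+ t) (*-distribˡ-+ (tail f) g h n))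
        (lemma (f 0) (g (suc n)) (h (suc n)) ((tail f * g) n) ((tail f * h) n))
  where
  lemma : ∀ a b c d e →
          a ℤ.* (b ℤ.+ c) ℤ.+ (d ℤ.+ e) ≡ (a ℤ.* b ℤ.+ d) ℤ.+ (a ℤ.* c ℤ.+ e)
  lemma = solve-∀

*-assoc : ∀ f g h → (f * g) * h ≈ f * (g * h)
*-assoc f g h zero    = lemma (f 0) (g 0) (h 0)
  where
  lemma : ∀ a b c → (a ℤ.* b ℤ.+ 0ℤ) ℤ.* c ℤ.+ 0ℤ ≡ a ℤ.* (b ℤ.* c ℤ.+ 0ℤ) ℤ.+ 0ℤ
  lemma = solve-∀
*-assoc f g h (suc n) = begin
  (f 0 ℤ.* g 0 ℤ.+ 0ℤ) ℤ.* h (suc n) ℤ.+ ((f 0 · tail g + tail f * g) * h) n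
    ≡⟨ cong (λ t → (f 0 ℤ.* g 0 ℤ.+ 0ℤ) ℤ.* h (suc n) ℤ.+ t)
         (*-distribʳ-+ h (f 0 · tail g) (tail f * g) n) ⟩
  (f 0 ℤ.* g 0 ℤ.+ 0ℤ) ℤ.* h (suc n) ℤ.+ (((f 0 · tail g) * h) n ℤ.+ ((tail f * g) * h) n)
    ≡⟨ cong₂ (λ s t → (f 0 ℤ.* g 0 ℤ.+ 0ℤ) ℤ.* h (suc n) ℤ.+ (s ℤ.+ t))
         (·-*-assoc (f 0) (tail g) h n) (*-assoc (tail f) g h n) ⟩
  (f 0 ℤ.* g 0 ℤ.+ 0ℤ) ℤ.* h (suc n) ℤ.+ (f 0 ℤ.* (tail g * h) n ℤ.+ (tail f * (g * h)) n)
    ≡⟨ lemma (f 0) (g 0) (h (suc n)) _ _ ⟩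
  f 0 ℤ.* (g 0 ℤ.* h (suc n) ℤ.+ (tail g * h) n) ℤ.+ (tail f * (g * h)) n ∎
  where
  open ≡-Reasoning
  lemma : ∀ a b c s t →
          (a ℤ.* b ℤ.+ 0ℤ) ℤ.* c ℤ.+ (a ℤ.* s ℤ.+ t) ≡ a ℤ.* (b ℤ.* c ℤ.+ s) ℤ.+ t
  lemma = solve-∀

-- Together with /-correct: for g with constant term 1, the quotient f / g is
-- the only series h with h * g ≈ f.
/-unique : ∀ {f g} h → g 0 ≡ 1ℤ → h * g ≈ f → f / g ≈ h
/-unique {f} {g} h g₀≡1 hg≈f zero = begin
  f 0                  ≡⟨ hg≈f 0 ⟨
  h 0 ℤ.* g 0 ℤ.+ 0ℤ   ≡⟨ ℤ.+-identityʳ _ ⟩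
  h 0 ℤ.* g 0          ≡⟨ cong (h 0 ℤ.*_) g₀≡1 ⟩
  h 0 ℤ.* 1ℤ           ≡⟨ ℤ.*-identityʳ _ ⟩
  h 0                  ∎
  where open ≡-Reasoning
/-unique {f} {g} h g₀≡1 hg≈f (suc n) = /-unique (tail h) g₀≡1 tail-hg n
  where
  open ≡-Reasoning
  cancel : ∀ a b → b ≡ (a ℤ.+ b) ℤ.- a
  cancel = solve-∀
  tail-hg : tail h * g ≈ (λ m → f (suc m) ℤ.- f 0 ℤ.* g (suc m))
  tail-hg m = begin
    (tail h * g) m
      ≡⟨ cancel (h 0 ℤ.* g (suc m)) _ ⟩
    (h * g) (suc m) ℤ.- h 0 ℤ.* g (suc m)
      ≡⟨ cong₂ (λ a b → a ℤ.- b ℤ.* g (suc m)) (hg≈f (suc m))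
               (sym (/-unique {f} {g} h g₀≡1 hg≈f zero)) ⟩
    f (suc m) ℤ.- f 0 ℤ.* g (suc m) ∎

/-congˡ : ∀ {f f′ g} → g 0 ≡ 1ℤ → f ≈ f′ → f / g ≈ f′ / g
/-congˡ {f} {f′} {g} g₀≡1 f≈f′ =
  /-unique (f′ / g) g₀≡1 (λ n → trans (/-correct f′ g g₀≡1 n) (sym (f≈f′ n)))

/-distribʳ-+ : ∀ f f′ g → g 0 ≡ 1ℤ → (f + f′) / g ≈ f / g + f′ / g
/-distribʳ-+ f f′ g g₀≡1 = /-unique (f / g + f′ / g) g₀≡1 (begin
  (f / g + f′ / g) * g          ≈⟨ *-distribʳ-+ g (f / g) (f′ / g) ⟩
  (f / g) * g + (f′ / g) * g    ≈⟨ +-cong (/-correct f g g₀≡1) (/-correct f′ g g₀≡1) ⟩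
  f + f′                        ∎)
  where open ≈-Reasoning

/-cancelʳ : ∀ f g h → g 0 ≡ 1ℤ → (g * h) 0 ≡ 1ℤ → (f * h) / (g * h) ≈ f / g
/-cancelʳ f g h g₀≡1 gh₀≡1 = /-unique (f / g) gh₀≡1 (begin
  f / g * (g * h)    ≈⟨ *-assoc (f / g) g h ⟨
  f / g * g * h      ≈⟨ *-congʳ h (/-correct f g g₀≡1) ⟩
  f * h              ∎)
  where open ≈-Reasoning

x*-suc : ∀ f n → (x * f) (suc n) ≡ f n
x*-suc f n = begin
  0ℤ ℤ.+ (tail x * f) n    ≡⟨ ℤ.+-identityˡ _ ⟩
  (tail x * f) n           ≡⟨ *-congʳ f tail-x n ⟩
  (const 1ℤ * f) n         ≡⟨ *-identityˡ f n ⟩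
  f n                      ∎
  where
  open ≡-Reasoning
  tail-x : tail x ≈ const 1ℤ
  tail-x zero    = refl
  tail-x (suc n) = refl

x^n*x≈x^[1+n] : ∀ n → x ^ n * x ≈ x ^ suc n
x^n*x≈x^[1+n] zero    = λ n → trans (*-identityˡ x n) (sym (*-identityʳ x n))
x^n*x≈x^[1+n] (suc n) = begin
  x * x ^ n * x      ≈⟨ *-assoc x (x ^ n) x ⟩
  x * (x ^ n * x)    ≈⟨ *-congˡ x (x^n*x≈x^[1+n] n) ⟩
  x ^ suc (suc n)    ∎
  where open ≈-Reasoning

-- Factors 1 - jx

1-jx-0 : ∀ j → (1- j ·x) 0 ≡ 1ℤ
1-jx-0 j = lemma (+ j)
  where
  lemma : ∀ a → 1ℤ ℤ.- (a ℤ.* 0ℤ ℤ.+ 0ℤ) ≡ 1ℤ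
  lemma = solve-∀

1-jx-1 : ∀ j → (1- j ·x) 1 ≡ ℤ.- (+ j)
1-jx-1 j = lemma (+ j)
  where
  lemma : ∀ a → 0ℤ ℤ.- (a ℤ.* 1ℤ ℤ.+ (0ℤ ℤ.* 0ℤ ℤ.+ 0ℤ)) ≡ ℤ.- a
  lemma = solve-∀

1-jx-≥2 : ∀ j n → (1- j ·x) (suc (suc n)) ≡ 0ℤ
1-jx-≥2 j n = trans (cong (λ t → 0ℤ ℤ.- (+ j ℤ.* 0ℤ ℤ.+ t)) (*-zeroˡ x (suc n))) (lemma (+ j))
  where
  lemma : ∀ a → 0ℤ ℤ.- (a ℤ.* 0ℤ ℤ.+ 0ℤ) ≡ 0ℤ
  lemma = solve-∀

1-suc : ∀ j → 1- suc j ·x + x ≈ 1- j ·x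
1-suc j 0 = trans (ℤ.+-identityʳ _) (trans (1-jx-0 (suc j)) (sym (1-jx-0 j)))
1-suc j 1 = trans (cong (λ t → t ℤ.+ 1ℤ) (1-jx-1 (suc j)))
  (trans (lemma (+ j)) (sym (1-jx-1 j)))
  where
  lemma : ∀ a → ℤ.- (1ℤ ℤ.+ a) ℤ.+ 1ℤ ≡ ℤ.- a
  lemma = solve-∀
1-suc j (suc (suc n)) = trans (ℤ.+-identityʳ _) (trans (1-jx-≥2 (suc j) n) (sym (1-jx-≥2 j n)))

*1-jx-zero : ∀ f j → (f * 1- j ·x) 0 ≡ f 0
*1-jx-zero f j = trans (cong (λ c → f 0 ℤ.* c ℤ.+ 0ℤ) (1-jx-0 j)) (lemma (f 0))
  where
  lemma : ∀ a → a ℤ.* 1ℤ ℤ.+ 0ℤ ≡ a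
  lemma = solve-∀

*1-jx-suc : ∀ f j n → (f * 1- j ·x) (suc n) ≡ f (suc n) ℤ.- + j ℤ.* f n
*1-jx-suc f j zero    =
  trans (cong₂ (λ c d → f 0 ℤ.* c ℤ.+ d) (1-jx-1 j) (*1-jx-zero (tail f) j)) (lemma (f 0) (f 1) (+ j))
  where
  lemma : ∀ a b c → a ℤ.* ℤ.- c ℤ.+ b ≡ b ℤ.- c ℤ.* a
  lemma = solve-∀
*1-jx-suc f j (suc n) =
  trans (cong₂ (λ c d → f 0 ℤ.* c ℤ.+ d) (1-jx-≥2 j n) (*1-jx-suc (tail f) j n)) (lemma (f 0) _)
  where
  lemma : ∀ a b → a ℤ.* 0ℤ ℤ.+ b ≡ b
  lemma = solve-∀

-- A sequence with f (n + 1) = j f n + g n and f 0 = 1 has the generating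
-- function (1 + x g) / (1 - jx).
linear-recurrence : ∀ f g j → f 0 ≡ 1ℤ → (∀ n → f (suc n) ≡ + j ℤ.* f n ℤ.+ g n) →
                    f * 1- j ·x ≈ const 1ℤ + x * g
linear-recurrence f g j f₀ fₛ zero    = trans (*1-jx-zero f j) f₀
linear-recurrence f g j f₀ fₛ (suc n) = begin
  (f * 1- j ·x) (suc n)                          ≡⟨ *1-jx-suc f j n ⟩
  f (suc n) ℤ.- + j ℤ.* f n                      ≡⟨ cong (λ t → t ℤ.- + j ℤ.* f n) (fₛ n) ⟩
  (+ j ℤ.* f n ℤ.+ g n) ℤ.- + j ℤ.* f n          ≡⟨ lemma (+ j ℤ.* f n) (g n) ⟩
  0ℤ ℤ.+ g n                                     ≡⟨ cong (λ t → 0ℤ ℤ.+ t) (x*-suc g n) ⟨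
  (const 1ℤ + x * g) (suc n)                     ∎
  where
  open ≡-Reasoning
  lemma : ∀ a b → (a ℤ.+ b) ℤ.- a ≡ 0ℤ ℤ.+ b
  lemma = solve-∀

-- Unrolling the recurrence between consecutive states

-- The denominator that arises from eliminating the first k states.
P : ℕ → PowerSeries
P k = Π[ j ∈1⋯ k ] 1- j ·x

/-extendP : ∀ f k → f / P k ≈ (f * 1- suc k ·x) / P (suc k)
/-extendP f k n = sym (/-cancelʳ f (P k) (1- suc k ·x) (Π₀≡1 k) (Π₀≡1 (suc k)) n)

-- If C_i (1 - ix) = 1 + x C_{i+1} for all i ≤ k, then C_1 can be eliminated
-- in favour of C_{k+1}: at each step the summand x^i C_i / P (i - 1) is
-- expanded by 1 - ix and splits into x^i / P i and x^(i+1) C_{i+1} / P i.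
unroll-recurrence : (C : ℕ → PowerSeries) → ∀ k →
  (∀ i → i ≤ k → C i * 1- i ·x ≈ const 1ℤ + x * C (suc i)) →
  x * C 1 ≈ x ^ suc k * C (suc k) / P k + (Σ[ i ∈1⋯ k ] (x ^ i / P i))
unroll-recurrence C zero    _   = begin
  x * C 1                       ≈⟨ *-congʳ (C 1) (*-identityʳ x) ⟨
  x ^ 1 * C 1                   ≈⟨ /-unique (x ^ 1 * C 1) refl (*-identityʳ (x ^ 1 * C 1)) ⟨
  x ^ 1 * C 1 / P 0             ≈⟨ +-const-0 (x ^ 1 * C 1 / P 0) ⟨
  x ^ 1 * C 1 / P 0 + const 0ℤ  ∎
  where
  open ≈-Reasoning
  +-const-0 : ∀ f → f + const 0ℤ ≈ f
  +-const-0 f zero    = ℤ.+-identityʳ _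
  +-const-0 f (suc n) = ℤ.+-identityʳ _
unroll-recurrence C (suc k) rec = begin
  x * C 1
    ≈⟨ unroll-recurrence C k (λ i i≤k → rec i (ℕ.m≤n⇒m≤1+n i≤k)) ⟩
  x ^ suc k * C (suc k) / P k + S
    ≈⟨ +-cong {g = S} split (λ _ → refl) ⟩
  (x ^ suc k / P (suc k) + rest) + S
    ≈⟨ (λ n → rearrange ((x ^ suc k / P (suc k)) n) (rest n) (S n)) ⟩
  rest + (S + x ^ suc k / P (suc k)) ∎
  where
  open ≈-Reasoning
  S rest : PowerSeries
  S    = Σ[ i ∈1⋯ k ] (x ^ i / P i)
  rest = x ^ suc (suc k) * C (suc (suc k)) / P (suc k)

  rearrange : ∀ a b c → (a ℤ.+ b) ℤ.+ c ≡ b ℤ.+ (c ℤ.+ a)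
  rearrange = solve-∀

  numerator : x ^ suc k * C (suc k) * 1- suc k ·x ≈ x ^ suc k + x ^ suc (suc k) * C (suc (suc k))
  numerator = begin
    x ^ suc k * C (suc k) * 1- suc k ·x
      ≈⟨ *-assoc (x ^ suc k) (C (suc k)) (1- suc k ·x) ⟩
    x ^ suc k * (C (suc k) * 1- suc k ·x)
      ≈⟨ *-congˡ (x ^ suc k) (rec (suc k) ℕ.≤-refl) ⟩
    x ^ suc k * (const 1ℤ + x * C (suc (suc k)))
      ≈⟨ *-distribˡ-+ (x ^ suc k) (const 1ℤ) (x * C (suc (suc k))) ⟩
    x ^ suc k * const 1ℤ + x ^ suc k * (x * C (suc (suc k)))
      ≈⟨ +-cong (*-identityʳ (x ^ suc k)) (λ n → sym (*-assoc (x ^ suc k) x (C (suc (suc k))) n)) ⟩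
    x ^ suc k + x ^ suc k * x * C (suc (suc k))
      ≈⟨ +-cong {x ^ suc k} (λ _ → refl) (*-congʳ (C (suc (suc k))) (x^n*x≈x^[1+n] (suc k))) ⟩
    x ^ suc k + x ^ suc (suc k) * C (suc (suc k)) ∎

  split : x ^ suc k * C (suc k) / P k ≈ x ^ suc k / P (suc k) + rest
  split = begin
    x ^ suc k * C (suc k) / P k
      ≈⟨ /-extendP (x ^ suc k * C (suc k)) k ⟩
    x ^ suc k * C (suc k) * 1- suc k ·x / P (suc k)
      ≈⟨ /-congˡ (Π₀≡1 (suc k)) numerator ⟩
    (x ^ suc k + x ^ suc (suc k) * C (suc (suc k))) / P (suc k)
      ≈⟨ /-distribʳ-+ (x ^ suc k) (x ^ suc (suc k) * C (suc (suc k))) (P (suc k)) (Π₀≡1 (suc k)) ⟩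
    x ^ suc k / P (suc k) + rest ∎

-- The generating function

-- The generating function, by length, of the walks starting with maximum m.
walkSeries : ℕ → ℕ → PowerSeries
walkSeries r m n = + #walks r n m

walkSeries-rec : ∀ r m → m ≤ r → walkSeries r m * 1- m ·x ≈ const 1ℤ + x * walkSeries r (suc m)
walkSeries-rec r m m≤r = linear-recurrence (walkSeries r m) (walkSeries r (suc m)) m refl λ n → begin
  + #walks r (suc n) m
    ≡⟨ cong +_ (#walks-suc r n m) ⟩
  + ((m ℕ.⊓ r) ℕ.* #walks r n m ℕ.+ #walks r n (suc m))
    ≡⟨ cong (λ k → + (k ℕ.* #walks r n m ℕ.+ #walks r n (suc m))) (ℕ.m≤n⇒m⊓n≡m m≤r) ⟩
  + (m ℕ.* #walks r n m ℕ.+ #walks r n (suc m))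
    ≡⟨ ℤ.pos-+ (m ℕ.* #walks r n m) _ ⟩
  + (m ℕ.* #walks r n m) ℤ.+ + #walks r n (suc m)
    ≡⟨ cong (λ t → t ℤ.+ + #walks r n (suc m)) (ℤ.pos-* m _) ⟩
  + m ℤ.* + #walks r n m ℤ.+ + #walks r n (suc m) ∎
  where open ≡-Reasoning

walkSeries-saturated : ∀ r → walkSeries r (suc r) ≈ walkSeries r r
walkSeries-saturated r n = cong +_ (#walks-saturated r n r ℕ.≤-refl)

-- C_r = C_{r+1} turns the recurrence for C_r into C_r (1 - rx) = 1 + x C_r,
-- that is, C_r (1 - (r+1)x) = 1.
walkSeries-inverse : ∀ r → walkSeries r r * 1- suc r ·x ≈ const 1ℤ
walkSeries-inverse r zero    = *1-jx-zero (walkSeries r r) (suc r)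
walkSeries-inverse r (suc n) = begin
  (C r * 1- suc r ·x) (suc n)               ≡⟨ *1-jx-suc (C r) (suc r) n ⟩
  C r (suc n) ℤ.- (1ℤ ℤ.+ + r) ℤ.* C r n    ≡⟨ lemma (C r (suc n)) (+ r) (C r n) ⟩
  (C r (suc n) ℤ.- + r ℤ.* C r n) ℤ.- C r n ≡⟨ cong (λ t → t ℤ.- C r n) (*1-jx-suc (C r) r n) ⟨
  (C r * 1- r ·x) (suc n) ℤ.- C r n         ≡⟨ cong (λ t → t ℤ.- C r n) (walkSeries-rec r r ℕ.≤-refl (suc n)) ⟩
  (0ℤ ℤ.+ (x * C (suc r)) (suc n)) ℤ.- C r n ≡⟨ cong (λ t → (0ℤ ℤ.+ t) ℤ.- C r n)
                                                 (trans (x*-suc (C (suc r)) n) (walkSeries-saturated r n)) ⟩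
  (0ℤ ℤ.+ C r n) ℤ.- C r n                   ≡⟨ lemma′ (C r n) ⟩
  0ℤ ∎
  where
  open ≡-Reasoning
  C : ℕ → PowerSeries
  C = walkSeries r
  lemma : ∀ a b c → a ℤ.- (1ℤ ℤ.+ b) ℤ.* c ≡ (a ℤ.- b ℤ.* c) ℤ.- c
  lemma = solve-∀
  lemma′ : ∀ a → (0ℤ ℤ.+ a) ℤ.- a ≡ 0ℤ
  lemma′ = solve-∀

-- `walkSeries-inverse` with the factor 1 - rx in between. Rewriting
-- C_r (1 - rx) as 1 + x C_{r+1} leads to 1 - (r+1)x + x without commuting any
-- factors.
walkSeries-numerator : ∀ r → walkSeries r r * 1- r ·x * 1- suc r ·x ≈ 1- r ·x
walkSeries-numerator r = begin
  C r * 1- r ·x * 1- suc r ·x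
    ≈⟨ *-congʳ (1- suc r ·x) (walkSeries-rec r r ℕ.≤-refl) ⟩
  (const 1ℤ + x * C (suc r)) * 1- suc r ·x
    ≈⟨ *-distribʳ-+ (1- suc r ·x) (const 1ℤ) (x * C (suc r)) ⟩
  const 1ℤ * 1- suc r ·x + x * C (suc r) * 1- suc r ·x
    ≈⟨ +-cong (*-identityˡ (1- suc r ·x)) (*-assoc x (C (suc r)) (1- suc r ·x)) ⟩
  1- suc r ·x + x * (C (suc r) * 1- suc r ·x)
    ≈⟨ +-cong {1- suc r ·x} (λ _ → refl) (*-congˡ x (*-congʳ (1- suc r ·x) (walkSeries-saturated r))) ⟩
  1- suc r ·x + x * (C r * 1- suc r ·x)
    ≈⟨ +-cong {1- suc r ·x} (λ _ → refl) (*-congˡ x (walkSeries-inverse r)) ⟩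
  1- suc r ·x + x * const 1ℤ
    ≈⟨ +-cong {1- suc r ·x} (λ _ → refl) (*-identityʳ x) ⟩
  1- suc r ·x + x
    ≈⟨ 1-suc r ⟩
  1- r ·x ∎
  where
  open ≈-Reasoning
  C : ℕ → PowerSeries
  C = walkSeries r

-- Every nonempty walk from 0 starts with the letter 1, which gives the factor
-- x; the empty sequence contributes to neither side.
generatingFunction≈ : ∀ r →
  generatingFunction (λ n → ∣𝒫∣ n [ 12⋯ suc r ⟨1⟩ ]) ≈ x * walkSeries r 1
generatingFunction≈ r zero    = sym (trans (ℤ.+-identityʳ _) (ℤ.*-zeroˡ (walkSeries r 1 0)))
generatingFunction≈ r (suc n) = begin
  + ∣𝒫∣ (suc n) [ 12⋯ suc r ⟨1⟩ ]   ≡⟨ cong +_ (∣𝒫∣≡#walks r n) ⟩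
  + #walks r (suc n) 0              ≡⟨ cong +_ (#walks-suc r n 0) ⟩
  + #walks r n 1                    ≡⟨ x*-suc (walkSeries r 1) n ⟨
  (x * walkSeries r 1) (suc n)      ∎
  where open ≡-Reasoning

-- C_r = 1 / (1 - (r+1)x) is brought to the denominator P (r + 1) by expanding
-- with both 1 - rx and 1 - (r+1)x.
remainder : ∀ k → let r = suc k in
  x ^ r * walkSeries r r / P k ≈ x ^ r * 1- r ·x / P (suc r)
remainder k = begin
  x ^ r * W / P k
    ≈⟨ /-extendP (x ^ r * W) k ⟩
  x ^ r * W * 1- r ·x / P r
    ≈⟨ /-extendP (x ^ r * W * 1- r ·x) r ⟩
  x ^ r * W * 1- r ·x * 1- suc r ·x / P (suc r)
    ≈⟨ /-congˡ (Π₀≡1 (suc r)) numerator ⟩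
  x ^ r * 1- r ·x / P (suc r) ∎
  where
  open ≈-Reasoning
  r : ℕ
  r = suc k
  W : PowerSeries
  W = walkSeries r r
  numerator : x ^ r * W * 1- r ·x * 1- suc r ·x ≈ x ^ r * 1- r ·x
  numerator = begin
    x ^ r * W * 1- r ·x * 1- suc r ·x    ≈⟨ *-congʳ (1- suc r ·x) (*-assoc (x ^ r) W (1- r ·x)) ⟩
    x ^ r * (W * 1- r ·x) * 1- suc r ·x  ≈⟨ *-assoc (x ^ r) (W * 1- r ·x) (1- suc r ·x) ⟩
    x ^ r * (W * 1- r ·x * 1- suc r ·x)  ≈⟨ *-congˡ (x ^ r) (walkSeries-numerator r) ⟩
    x ^ r * 1- r ·x                      ∎

theorem5p4 : (ℓ : ℕ) → 2 ≤ ℓ →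
    generatingFunction (λ n → ∣𝒫∣ n [ 12⋯ ℓ ⟨1⟩ ])
    ≈ (x ^ (ℓ ∸ 1) * 1- (ℓ ∸ 1) ·x) / (Π[ j ∈1⋯ ℓ ] 1- j ·x)
    + (Σ[ i ∈1⋯ ℓ ∸ 2 ] (x ^ i / (Π[ j ∈1⋯ i ] 1- j ·x)))
theorem5p4 (suc (suc k)) (s≤s (s≤s _)) = begin
  generatingFunction (λ n → ∣𝒫∣ n [ 12⋯ suc r ⟨1⟩ ])
    ≈⟨ generatingFunction≈ r ⟩
  x * walkSeries r 1
    ≈⟨ unroll-recurrence (walkSeries r) k (λ i i≤k → walkSeries-rec r i (ℕ.m≤n⇒m≤1+n i≤k)) ⟩
  x ^ r * walkSeries r r / P k + S
    ≈⟨ +-cong {g = S} (remainder k) (λ _ → refl) ⟩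
  x ^ r * 1- r ·x / P (suc r) + S ∎
  where
  open ≈-Reasoning
  r : ℕ
  r = suc k
  S : PowerSeries
  S = Σ[ i ∈1⋯ k ] (x ^ i / P i)
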